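{- Let $n \ge 1$ and $k \geq 1$ be integers, and let $\mathcal{M}_k(K_n)$ be the set of ordered matchings of size $k$ in the complete graph $K_n$. A universal cycle for $\mathcal{M}_k(K_n)$ exists except when $n \ge 4$ is even and $k = \frac{n}{2}$, in which case no universal cycle for $\mathcal{M}_k(K_n)$ exists. In other words, universal cycles for the ordered matchings of size $k$ in the complete graph exist except when they are perfect matchings with more than one edge.
   Context: $K_n$ is the complete graph on vertex set $\{0,1,\ldots,n-1\}$. An ordered matching of size $k$ in an undirected graph $G$ is an ordered list $[e_1,e_2,\ldots,e_k]$ of $k$ distinct undirected edges of $G$ such that $\{e_1,\ldots,e_k\}$ is a matching (the edges are pairwise vertex-disjoint). $\mathcal{M}_k(G)$ is the set of all ordered matchings of size $k$ in $G$. A universal cycle of $\mathcal{M}_k(G)$ is a cyclic sequence $c_0 c_1 \cdots c_{N-1}$ of edges of $G$ of length $N = |\mathcal{M}_k(G)|$ (indices modulo $N$) such that every $L \in \mathcal{M}_k(G)$ occurs exactly once as a list of $k$ consecutive terms $[c_i, c_{i+1},\ldots,c_{i+k-1}]$, $0 \le i < N$. Each edge is an unordered indivisible symbol. If $\mathcal{M}_k(G) = \emptyset$, the empty sequence counts as a universal cycle. -}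

module Defs where

open import Data.Fin.Base using (Fin; toℕ; _<_)
open import Data.Fin.Properties using (_≟_; nonZeroIndex)
open import Data.Nat.Base as ℕ using (ℕ; _≥_)
open import Data.Nat.DivMod using (_/_; _mod_)
open import Data.Nat.Divisibility using (_∣_)
open import Data.Product using (Σ; ∃; ∃!; _×_)
open import Data.Sum.Base using (_⊎_)
open import Data.Vec.Base using (Vec; tabulate)
open import Data.Vec.Functional using (Vector)
open import Data.Vec.Relation.Unary.AllPairs using (AllPairs)
open import Data.Vec.Relation.Unary.Unique.Propositional using (Unique)
open import Function.Base using (_∘_)
open import Function.Bundles using (_↔_)
open import Level using (0ℓ)
open import Relation.Binary.Core using (Rel)
open import Relation.Binary.Definitions using (Decidable; Irreflexive; Symmetric)
open import Relation.Binary.PropositionalEquality using (_≡_; _≢_; sym)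
open import Relation.Nullary using (¬_)
open import Relation.Nullary.Decidable using (¬?)

record Graph (n : ℕ) : Set₁ where
  field
    Adj    : Rel (Fin n) 0ℓ
    adj?   : Decidable Adj
    symm   : Symmetric Adj
    irrefl : Irreflexive _≡_ Adj

open Graph public

K : ∀ n → Graph n
K n = record
  { Adj    = _≢_
  ; adj?   = λ u v → ¬? (u ≟ v)
  ; symm   = λ u≢v → u≢v ∘ sym
  ; irrefl = λ u≡v u≢v → u≢v u≡v
  }

-- The undirected edge {u , v} is represented once, by listing its smaller
-- endpoint first.  Proof fields are irrelevant here and in OrderedMatching, so
-- that _≡_ is equality of the underlying unordered pairs, respectively lists.
record Edge {n} (G : Graph n) : Set where
  constructor mkEdge
  field
    lo hi     : Fin n
    .lo<hi    : lo < hi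
    .adjacent : Adj G lo hi

open Edge public using (lo; hi)

module _ {n} {G : Graph n} where

  _∈ᵉ_ : Fin n → Edge G → Set
  v ∈ᵉ e = v ≡ lo e ⊎ v ≡ hi e

  Disjoint : Rel (Edge G) 0ℓ
  Disjoint e f = ∀ v → ¬ (v ∈ᵉ e × v ∈ᵉ f)

record OrderedMatching {n} (G : Graph n) (k : ℕ) : Set where
  constructor mkOrderedMatching
  field
    edges     : Vec (Edge G) k
    .distinct : Unique edges
    .disjoint : AllPairs Disjoint edges

open OrderedMatching public using (edges)

window : ∀ {A : Set} {N} → Vector A N → (k : ℕ) → Fin N → Vec A k
window {N = N} c k i = tabulate λ j → c ((toℕ i ℕ.+ toℕ j) mod N)
  where instance _ = nonZeroIndex i

IsUniversalCycle : ∀ {n} (G : Graph n) (k : ℕ) {N : ℕ} → Vector (Edge G) N → Set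
IsUniversalCycle G k {N} c =
  (Fin N ↔ OrderedMatching G k) ×
  (∀ (L : OrderedMatching G k) → ∃! _≡_ λ i → window c k i ≡ edges L)

HasUniversalCycle : ∀ {n} (G : Graph n) (k : ℕ) → Set
HasUniversalCycle G k =
  Σ ℕ λ N → ∃ λ (c : Vector (Edge G) N) → IsUniversalCycle G k c

Exceptional : ℕ → ℕ → Set
Exceptional n k = n ≥ 4 × 2 ∣ n × k ≡ n / 2

{-# OPTIONS --safe #-}

-- View an ordered matching as an arrow from the list of its first k − 1 edges to the list of its
-- last k − 1 edges; a universal cycle is then an Eulerian circuit.  The rotations of one matching
-- form a closed walk, and two matchings that differ only in the last edge leave the same state, so
-- the closed walks of their rotations can be joined.  All matchings end up in one closed walk as
-- soon as any two are connected by rotations and replacements of the last edge.  For 2k < n there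
-- always is an unused vertex, and endpoints can be moved one by one through unused vertices.  For
-- 2k = n the k − 1 edges shared by consecutive windows leave a single choice for the remaining
-- edge, so a universal cycle would only ever use the edges of its first window.
module Submission where

open import Defs
import Data.Fin.Base as Fin
open Fin using (Fin; toℕ)
import Data.Fin.Properties as Fin
open import Data.List.Base
  using ( List; []; _∷_; [_]; _++_; _∷ʳ_; length; lookup; concatMap; cartesianProduct
        ; cartesianProductWith; allFin; filter; initLast; _∷ʳ′_ )
open import Data.List.Membership.Propositional using (_∈_; _∉_)
open import Data.List.Membership.Propositional.Properties
open import Data.List.Properties
open import Data.List.Relation.Binary.Permutation.Propositional
  using (_↭_; ↭-refl; ↭-sym; ↭⇒↭ₛ; prep; swap)
open import Data.List.Relation.Binary.Permutation.Propositional.Properties as ↭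
  using (↭-length; ∷↭∷ʳ; shift; shifts)
import Data.List.Relation.Binary.Permutation.Setoid.Properties as ↭ₛ
open import Data.List.Relation.Unary.All as All using (All; []; _∷_)
import Data.List.Relation.Unary.All.Properties as All
open import Data.List.Relation.Unary.AllPairs as AllPairs using (AllPairs; []; _∷_)
open import Data.List.Relation.Unary.Any as Any using (here; there)
import Data.List.Relation.Unary.Any.Properties as Any
open import Data.List.Relation.Unary.Unique.Propositional using (Unique)
import Data.List.Relation.Unary.Unique.Propositional.Properties as Unique
open import Data.Nat.Base as ℕ using (ℕ; zero; suc; _+_; _*_; _≥_; NonZero; s≤s)
open import Data.Nat.DivMod
open import Data.Nat.Divisibility using (divides)
import Data.Nat.Properties as ℕ
open import Data.Product.Base using (∃; ∃₂; _×_; _,_; proj₁; proj₂; uncurry)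
open import Data.Sum.Base as Sum using (_⊎_; inj₁; inj₂)
open import Data.Vec.Base as Vec using (Vec; toList; tabulate; fromList)
open import Data.Vec.Functional using (Vector)
import Data.Vec.Properties as Vec
import Data.Vec.Relation.Unary.All.Properties as Vec
import Data.Vec.Relation.Unary.AllPairs as VecPairs
open import Function.Base using (_∘_; id; case_of_)
open import Function.Bundles using (mk↔ₛ′; module Inverse)
open import Level using (0ℓ)
open import Relation.Binary.Core using (Rel)
open import Relation.Binary.Definitions
  using (Decidable; DecidableEquality; Symmetric; tri<; tri≈; tri>)
open import Relation.Binary.PropositionalEquality hiding ([_])
open import Relation.Nullary using (¬_; Dec; yes; no; contradiction; recompute)
open import Relation.Nullary.Decidable using (¬?; _×-dec_; _⊎-dec_; map′)

-- Lists and residues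

AllPairs-resp-↭ : ∀ {A : Set} {R : Rel A 0ℓ} → Symmetric R →
                  ∀ {xs ys} → xs ↭ ys → AllPairs R xs → AllPairs R ys
AllPairs-resp-↭ {A} {R} R-sym p =
  ↭ₛ.AllPairs-resp-↭ (setoid A) R-sym (resp₂ R) (↭⇒↭ₛ p)

lookup-injective : ∀ {A : Set} {xs : List A} → Unique xs → ∀ i j → lookup xs i ≡ lookup xs j → i ≡ j
lookup-injective (d ∷ u) Fin.zero    Fin.zero    e = refl
lookup-injective (d ∷ u) Fin.zero    (Fin.suc j) e = contradiction e (All.lookup d (∈-lookup j))
lookup-injective (d ∷ u) (Fin.suc i) Fin.zero    e = contradiction (sym e) (All.lookup d (∈-lookup i))
lookup-injective (d ∷ u) (Fin.suc i) (Fin.suc j) e = cong Fin.suc (lookup-injective u i j e)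

suc-% : ∀ p N .{{_ : NonZero N}} → suc (p % N) % N ≡ suc p % N
suc-% p N = sym (trans (cong (λ q → suc q % N) (m≡m%n+[m/n]*n p N))
  ([m+kn]%n≡m%n (suc (p % N)) (p / N) N))

suc-mod : ∀ p N .{{_ : NonZero N}} → suc (toℕ (p mod N)) mod N ≡ suc p mod N
suc-mod p N = Fin.toℕ-injective (begin
  toℕ (suc (toℕ (p mod N)) mod N) ≡⟨ Fin.toℕ-fromℕ< _ ⟩
  suc (toℕ (p mod N)) % N         ≡⟨ cong (λ q → suc q % N) (Fin.toℕ-fromℕ< _) ⟩
  suc (p % N) % N                 ≡⟨ suc-% p N ⟩
  suc p % N                       ≡⟨ Fin.toℕ-fromℕ< _ ⟨
  toℕ (suc p mod N)               ∎)
  where open ≡-Reasoning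

toℕ-mod : ∀ {N} .{{_ : NonZero N}} (i : Fin N) → toℕ i mod N ≡ i
toℕ-mod i = Fin.toℕ-injective (trans (Fin.toℕ-fromℕ< _) (m<n⇒m%n≡m (Fin.toℕ<n i)))

-- Joining cycles

module CycleJoining
  {E : Set} (_≟ᴱ_ : DecidableEquality E)
  (D : Rel E 0ℓ) (D-sym : Symmetric D) (D-irrefl : ∀ {e} → ¬ D e e)
  (k : ℕ)
  where

  open import Data.List.Membership.DecPropositional (≡-dec _≟ᴱ_) using (_∈?_)

  Valid : List E → Set
  Valid x = length x ≡ k × AllPairs D x

  Valid-resp-↭ : ∀ {x y} → x ↭ y → Valid x → Valid y
  Valid-resp-↭ p (l , d) = trans (sym (↭-length p)) l , AllPairs-resp-↭ D-sym p d

  valid⇒unique : ∀ {x} → Valid x → Unique x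
  valid⇒unique (_ , d) = AllPairs.map (λ { d refl → D-irrefl d }) d

  -- A de Bruijn graph: the list s ∷ʳ b = a ∷ t is an arrow from its initial segment s to its
  -- tail t.
  data Path : List E → List (List E) → List E → Set where
    []  : ∀ {s} → Path s [] s
    _∷_ : ∀ {s t u a b L} → s ∷ʳ b ≡ a ∷ t → Path t L u → Path s ((s ∷ʳ b) ∷ L) u

  _++ᵖ_ : ∀ {s t u L M} → Path s L t → Path t M u → Path s (L ++ M) u
  []      ++ᵖ q = q
  (e ∷ p) ++ᵖ q = e ∷ (p ++ᵖ q)

  -- An arrow has its initial segment as source, so a path about to use `t ∷ʳ b` must be at state
  -- `t`.
  Path-split : ∀ {s u} L {t b M} → Path s (L ++ (t ∷ʳ b) ∷ M) u →
               Path s L t × Path t ((t ∷ʳ b) ∷ M) u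
  Path-split [] {t} p = at-start p refl
    where
    at-start : ∀ {s u z b M} → Path s (z ∷ M) u → z ≡ t ∷ʳ b →
               Path s [] t × Path t ((t ∷ʳ b) ∷ M) u
    at-start (_∷_ {s} e p) eq with refl , refl ← ∷ʳ-injective s t eq = [] , e ∷ p
  Path-split (x ∷ L) (e ∷ p) with q , r ← Path-split L p = e ∷ q , r

  -- Rotations of a list

  RotationClosed : List (List E) → Set
  RotationClosed L = ∀ {a u} → a ∷ u ∈ L → u ∷ʳ a ∈ L

  rotate∈ : ∀ {L} → RotationClosed L → ∀ xs ys → xs ++ ys ∈ L → ys ++ xs ∈ L
  rotate∈ {L} c []       ys p = subst (_∈ L) (sym (++-identityʳ ys)) p
  rotate∈ {L} c (x ∷ xs) ys p = subst (_∈ L) (∷ʳ-++ ys x xs)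
    (rotate∈ c xs (ys ∷ʳ x) (subst (_∈ L) (++-assoc xs ys [ x ]) (c p)))

  -- orbit xs ys lists the rotations of xs ++ ys whose first letter comes from ys.
  orbit : List E → List E → List (List E)
  orbit xs []       = []
  orbit xs (y ∷ ys) = (y ∷ ys ++ xs) ∷ orbit (xs ∷ʳ y) ys

  -- The tail of each rotation is the initial segment of the next. For empty `xs` the two equations
  -- describe the same list, so `s` and `u` agree and the walk closes.
  orbit-path : ∀ {u c s b} xs y ys → xs ++ y ∷ ys ≡ u ∷ʳ c → y ∷ ys ++ xs ≡ s ∷ʳ b →
               Path s (orbit xs (y ∷ ys)) u
  orbit-path {u} {s = s} {b} xs y [] e f with refl , refl ← ∷ʳ-injective xs u e
    rewrite f = sym f ∷ []
  orbit-path {s = s} {b} xs y ys@(z ∷ zs) e f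
    rewrite f = sym f ∷
      orbit-path (xs ∷ʳ y) z zs (trans (∷ʳ-++ xs y ys) e) (sym (++-assoc ys xs [ y ]))

  orbit-∈ : ∀ {z} xs ys → z ∈ orbit xs ys →
            ∃₂ λ ps q → ∃ λ qs → z ≡ q ∷ qs ++ ps × ps ++ q ∷ qs ≡ xs ++ ys × q ∈ ys
  orbit-∈ xs (y ∷ ys) (here e) = xs , y , ys , e , refl , here refl
  orbit-∈ xs (y ∷ ys) (there p) with ps , q , qs , e , f , m ← orbit-∈ (xs ∷ʳ y) ys p =
    ps , q , qs , e , trans f (∷ʳ-++ xs y ys) , there m

  -- Different rotations begin with different letters of `ys`.
  orbit-unique : ∀ xs {ys} → Unique ys → Unique (orbit xs ys)
  orbit-unique xs []       = []
  orbit-unique xs {y ∷ ys} (d ∷ u) = All.¬Any⇒All¬ _ fresh ∷ orbit-unique (xs ∷ʳ y) u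
    where
    fresh : (y ∷ ys ++ xs) ∉ orbit (xs ∷ʳ y) ys
    fresh p with _ , _ , _ , e , _ , m ← orbit-∈ (xs ∷ʳ y) ys p =
      All.lookup d m (∷-injectiveˡ e)

  -- Only the last list can rotate out of the orbit, and it rotates to `xs ++ ys`; for empty `xs`
  -- this is the first list again.
  orbit-next : ∀ xs ys {a u} → a ∷ u ∈ orbit xs ys →
               u ∷ʳ a ∈ orbit xs ys ⊎ u ∷ʳ a ≡ xs ++ ys
  orbit-next xs (y ∷ []) (here refl) = inj₂ refl
  orbit-next xs (y ∷ z ∷ ys) (here refl) = inj₁ (there (here (++-assoc (z ∷ ys) xs [ y ])))
  orbit-next xs (y ∷ ys) (there p) with orbit-next (xs ∷ʳ y) ys p
  ... | inj₁ q = inj₁ (there q)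
  ... | inj₂ e = inj₂ (trans e (∷ʳ-++ xs y ys))

  orbit-closed : ∀ ys → RotationClosed (orbit [] ys)
  orbit-closed ys@(_ ∷ _) p with orbit-next [] ys p
  ... | inj₁ q = q
  ... | inj₂ e = here (trans e (sym (++-identityʳ ys)))

  orbit-cycle : ∀ u {b} → Path u (orbit [] (u ∷ʳ b)) u
  orbit-cycle []      = orbit-path [] _ [] refl refl
  orbit-cycle (y ∷ u) = orbit-path [] y (u ∷ʳ _) refl (++-identityʳ (y ∷ u ∷ʳ _))

  orbit-self : ∀ u {b} → u ∷ʳ b ∈ orbit [] (u ∷ʳ b)
  orbit-self []      = here refl
  orbit-self (y ∷ u) = here (sym (++-identityʳ (y ∷ u ∷ʳ _)))

  orbit-valid : ∀ {x} → Valid x → All Valid (orbit [] x)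
  orbit-valid v = All.tabulate λ p → case orbit-∈ [] _ p of λ
    { (ps , q , qs , refl , refl , _) → Valid-resp-↭ (↭.++-comm ps (q ∷ qs)) v }

  -- Growing a closed walk

  record Joined (L : List (List E)) : Set where
    field
      {base}  : List E
      path    : Path base L base
      unique  : Unique L
      valid   : All Valid L
      rotates : RotationClosed L

  open Joined public

  -- The moves a joined walk can absorb: rotations stay inside it, and replacing the last letter
  -- keeps the state from which the new list departs.
  data _⇝_ (x : List E) : List E → Set where
    start   : x ⇝ x
    rotate  : ∀ {a u} → x ⇝ (a ∷ u) → x ⇝ (u ∷ʳ a)
    replace : ∀ {a b u} → x ⇝ (u ∷ʳ a) → Valid (u ∷ʳ b) → x ⇝ (u ∷ʳ b)

  rotate* : ∀ {x} xs ys → x ⇝ (xs ++ ys) → x ⇝ (ys ++ xs)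
  rotate* {x} [] ys p = subst (x ⇝_) (sym (++-identityʳ ys)) p
  rotate* {x} (y ∷ xs) ys p = subst (x ⇝_) (∷ʳ-++ ys y xs)
    (rotate* xs (ys ∷ʳ y) (subst (x ⇝_) (++-assoc xs ys [ y ]) (rotate p)))

  -- Rotate the entry to the end, replace it there, and rotate back.
  replace-at : ∀ {x a b} us vs → x ⇝ (us ++ a ∷ vs) → Valid (us ++ b ∷ vs) →
               x ⇝ (us ++ b ∷ vs)
  replace-at {x} {a} {b} us vs p v = subst (x ⇝_) (∷ʳ-++ us b vs) (rotate* vs (us ∷ʳ b) (restate
    (replace (subst (x ⇝_) (sym (++-assoc vs us [ a ])) rotated)
      (Valid-resp-↭ (subst (us ++ b ∷ vs ↭_) (sym (++-assoc vs us [ b ])) cycled) v))))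
    where
    restate : x ⇝ ((vs ++ us) ∷ʳ b) → x ⇝ (vs ++ us ∷ʳ b)
    restate = subst (x ⇝_) (++-assoc vs us [ b ])
    rotated : x ⇝ (vs ++ us ∷ʳ a)
    rotated = rotate* (us ∷ʳ a) vs (subst (x ⇝_) (sym (∷ʳ-++ us a vs)) p)
    cycled : us ++ b ∷ vs ↭ vs ++ us ∷ʳ b
    cycled = subst (_↭ vs ++ us ∷ʳ b) (∷ʳ-++ us b vs) (↭.++-comm (us ∷ʳ b) vs)

  orbit-joined : ∀ u {b} → Valid (u ∷ʳ b) → Joined (orbit [] (u ∷ʳ b))
  orbit-joined u v = record
    { path    = orbit-cycle u
    ; unique  = orbit-unique [] (valid⇒unique v)
    ; valid   = orbit-valid v
    ; rotates = orbit-closed (u ∷ʳ _)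
    }

  Extends : List (List E) → List E → Set
  Extends L y = ∃ λ L′ → Joined L′ × (∀ {z} → z ∈ L → z ∈ L′) × y ∈ L′

  -- Since x = u ∷ʳ a and y = u ∷ʳ b leave the same state u, the closed walk through the
  -- rotations of y can be spliced in just before x.
  insert-orbit : ∀ {L u a b} → Joined L → u ∷ʳ a ∈ L → Valid (u ∷ʳ b) → u ∷ʳ b ∉ L →
                 Extends L (u ∷ʳ b)
  insert-orbit {L} {u} {a} {b} J x∈L v y∉L with A , B , refl ← ∈-∃++ x∈L =
    A ++ O ++ x ∷ B , record
      { path    = proj₁ path-AB ++ᵖ (orbit-cycle u ++ᵖ proj₂ path-AB)
      ; unique  = AllPairs-resp-↭ (_∘ sym) (shifts O A)
                    (Unique.++⁺ (orbit-unique [] (valid⇒unique v)) (unique J) apart)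
      ; valid   = All.++⁺ (All.++⁻ˡ A (valid J)) (All.++⁺ (orbit-valid v) (All.++⁻ʳ A (valid J)))
      ; rotates = λ p → split⁺ (Sum.map (orbit-closed (u ∷ʳ b)) (rotates J) (split⁻ p))
      } , split⁺ ∘ inj₂ , split⁺ (inj₁ (orbit-self u))
    where
    x = u ∷ʳ a
    O = orbit [] (u ∷ʳ b)
    path-AB : Path (base J) A u × Path u (x ∷ B) (base J)
    path-AB = Path-split A (path J)
    -- A rotation of `u ∷ʳ b` inside `L` would, by closure, bring `u ∷ʳ b` itself into `L`.
    apart : ∀ {z} → ¬ (z ∈ O × z ∈ A ++ x ∷ B)
    apart (z∈O , z∈L) with ps , q , qs , refl , e , _ ← orbit-∈ [] (u ∷ʳ b) z∈O =
      y∉L (subst (_∈ L) e (rotate∈ (rotates J) (q ∷ qs) ps z∈L))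
    split⁻ : ∀ {z} → z ∈ A ++ O ++ x ∷ B → z ∈ O ⊎ z ∈ A ++ x ∷ B
    split⁻ p = ∈-++⁻ O (↭.∈-resp-↭ (shifts A O) p)
    split⁺ : ∀ {z} → z ∈ O ⊎ z ∈ A ++ x ∷ B → z ∈ A ++ O ++ x ∷ B
    split⁺ (inj₁ q) = ∈-++⁺ʳ A (∈-++⁺ˡ q)
    split⁺ (inj₂ q) = ↭.∈-resp-↭ (shifts O A) (∈-++⁺ʳ O q)

  -- Induction on the moves. Closure handles a rotation; a replacement either is listed already or
  -- has its whole orbit spliced in.
  extend : ∀ {L x y} → Joined L → x ∈ L → x ⇝ y → Extends L y
  extend J x∈L start = _ , J , (λ p → p) , x∈L
  extend J x∈L (rotate r) with _ , J′ , ⊆ , y∈ ← extend J x∈L r = _ , J′ , ⊆ , rotates J′ y∈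
  extend J x∈L (replace {b = b} {u} r v) with L′ , J′ , ⊆ , y∈ ← extend J x∈L r | (u ∷ʳ b) ∈? L′
  ... | yes p = _ , J′ , ⊆ , p
  ... | no ¬p with _ , J″ , ⊆′ , z∈ ← insert-orbit J′ y∈ v ¬p = _ , J″ , ⊆′ ∘ ⊆ , z∈

  extend-all : ∀ {L x ys} → Joined L → x ∈ L → All (x ⇝_) ys →
               ∃ λ L′ → Joined L′ × (∀ {z} → z ∈ L → z ∈ L′) × All (_∈ L′) ys
  extend-all J x∈L [] = _ , J , (λ p → p) , []
  extend-all J x∈L (r ∷ rs) with _ , J′ , ⊆ , y∈ ← extend J x∈L r
    with _ , J″ , ⊆′ , ys∈ ← extend-all J′ (⊆ x∈L) rs = _ , J″ , ⊆′ ∘ ⊆ , ⊆′ y∈ ∷ ys∈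

  -- Reading a cyclic sequence off a closed walk

  Step : List E → List E → Set
  Step x y = ∃₂ λ a u → ∃ λ b → x ≡ a ∷ u × y ≡ u ∷ʳ b

  path-first : ∀ {s x L t} → Path s (x ∷ L) t → ∃ λ b → x ≡ s ∷ʳ b
  path-first (_∷_ {b = b} _ _) = b , refl

  path-last : ∀ {s L t} → Path s L t → ∀ i → suc (toℕ i) ≡ length L → ∃ λ a → lookup L i ≡ a ∷ t
  path-last (_∷_ {a = a} e []) Fin.zero _ = a , e
  path-last (_ ∷ p@(_ ∷ _)) (Fin.suc i) eq = path-last p i (ℕ.suc-injective eq)

  path-step : ∀ {s L t} → Path s L t → ∀ i j → toℕ j ≡ suc (toℕ i) → Step (lookup L i) (lookup L j)
  path-step (e ∷ (_ ∷ _)) Fin.zero    (Fin.suc Fin.zero) _  = _ , _ , _ , e , refl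
  path-step (_ ∷ p)        (Fin.suc i) (Fin.suc j)        eq = path-step p i j (ℕ.suc-injective eq)

  -- At the wrap-around, the last list has tail `s` and the first has initial segment `s`.
  cycle-step : ∀ {s x L} → Path s (x ∷ L) s → ∀ i →
               Step (lookup (x ∷ L) i) (lookup (x ∷ L) (suc (toℕ i) mod suc (length L)))
  cycle-step {x = x} {L} p i with suc (toℕ i) ℕ.<? suc (length L)
  ... | yes i+1<N = path-step p i _ (trans (Fin.toℕ-fromℕ< _) (m<n⇒m%n≡m i+1<N))
  ... | no  i+1≮N
    with i+1≡N ← ℕ.≤-antisym (Fin.toℕ<n i) (ℕ.≮⇒≥ i+1≮N)
    with a , e ← path-last p i i+1≡N | b , f ← path-first p
    = a , _ , b , e , trans (cong (lookup (x ∷ L)) wrap) f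
    where
    wrap : suc (toℕ i) mod suc (length L) ≡ Fin.zero
    wrap = Fin.toℕ-injective (trans (Fin.toℕ-fromℕ< _)
      (trans (cong (_% suc (length L)) i+1≡N) (n%n≡0 (suc (length L)))))

  -- A sequence of lists that overlap in all but one letter is read off from its first letters.
  reading : (f : ℕ → List E) (step : ∀ p → Step (f p) (f (suc p))) →
            ∀ n p t r → length t ≡ n → f p ≡ t ++ r →
            toList (tabulate {n = n} λ j → proj₁ (step (p + toℕ j))) ≡ t
  reading f step zero    p []      r l e = refl
  reading f step (suc n) p (x ∷ t) r l e = cong₂ _∷_
    (trans (cong (proj₁ ∘ step) (ℕ.+-identityʳ p)) (∷-injectiveˡ heads))
    (trans (cong toList (Vec.tabulate-cong λ j → cong (proj₁ ∘ step) (ℕ.+-suc p (toℕ j))))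
      -- The unread letters `t` stay in front, while `r` collects the letters shifted in at the end.
      (reading f step n (suc p) t (r ∷ʳ b) (ℕ.suc-injective l) (begin
        f (suc p)     ≡⟨ proj₂ (proj₂ (proj₂ (proj₂ (step p)))) ⟩
        u ∷ʳ b        ≡⟨ cong (_∷ʳ b) (∷-injectiveʳ heads) ⟩
        (t ++ r) ∷ʳ b ≡⟨ ++-assoc t r [ b ] ⟩
        t ++ r ∷ʳ b   ∎)))
    where
    open ≡-Reasoning
    u = proj₁ (proj₂ (step p))
    b = proj₁ (proj₂ (proj₂ (step p)))
    heads : proj₁ (step p) ∷ u ≡ x ∷ t ++ r
    heads = trans (sym (proj₁ (proj₂ (proj₂ (proj₂ (step p)))))) e

  cycle-windows : ∀ {L} → Joined L →
                  ∃ λ (c : Vector E (length L)) → ∀ i → toList (window c k i) ≡ lookup L i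
  cycle-windows {[]}    J = (λ ()) , λ ()
  cycle-windows {x ∷ L} J = (λ i → proj₁ (cycle-step (path J) i)) , λ i →
    reading f step k (toℕ i) (lookup (x ∷ L) i) [] (proj₁ (All.lookup (valid J) (∈-lookup i)))
      (trans (cong (lookup (x ∷ L)) (toℕ-mod i)) (sym (++-identityʳ _)))
    where
    -- The periodic extension to all natural numbers lets a window run past the end of the list.
    f : ℕ → List E
    f p = lookup (x ∷ L) (p mod suc (length L))
    step : ∀ p → Step (f p) (f (suc p))
    step p = let a , u , b , e , e′ = cycle-step (path J) (p mod suc (length L)) in
      a , u , b , e , trans (cong (lookup (x ∷ L)) (sym (suc-mod p _))) e′

-- Ordered matchings as lists of edges

module _ {A : Set} where

  listsOf : List A → ℕ → List (List A)
  listsOf xs zero    = [ [] ]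
  listsOf xs (suc k) = cartesianProductWith _∷_ xs (listsOf xs k)

  ∈-listsOf : ∀ {xs} → (∀ a → a ∈ xs) → ∀ ys → ys ∈ listsOf xs (length ys)
  ∈-listsOf all []       = here refl
  ∈-listsOf all (y ∷ ys) = ∈-cartesianProductWith⁺ _∷_ (all y) (∈-listsOf all ys)

module _ {A : Set} {R : Rel A 0ℓ} where

  toList⁺ : ∀ {n} {xs : Vec A n} → VecPairs.AllPairs R xs → AllPairs R (toList xs)
  toList⁺ VecPairs.[]       = []
  toList⁺ (r VecPairs.∷ rs) = Vec.toList⁺ r ∷ toList⁺ rs

  toList⁻ : ∀ {n} (xs : Vec A n) → AllPairs R (toList xs) → VecPairs.AllPairs R xs
  toList⁻ Vec.[]       []       = VecPairs.[]
  toList⁻ (x Vec.∷ xs) (r ∷ rs) = Vec.toList⁻ r VecPairs.∷ toList⁻ xs rs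

toList-inj : ∀ {A : Set} {n} (xs ys : Vec A n) → toList xs ≡ toList ys → xs ≡ ys
toList-inj xs ys e = trans (sym (Vec.cast-is-id refl xs)) (Vec.toList-injective refl xs ys e)

module Edges {n} (G : Graph n) where

  edge-≡ : ∀ {e f : Edge G} → lo e ≡ lo f → hi e ≡ hi f → e ≡ f
  edge-≡ refl refl = refl

  _≟ᴱ_ : DecidableEquality (Edge G)
  e ≟ᴱ f = map′ (uncurry edge-≡) (λ { refl → refl , refl }) (lo e Fin.≟ lo f ×-dec hi e Fin.≟ hi f)

  _∈ᵉ?_ : Decidable (_∈ᵉ_ {G = G})
  v ∈ᵉ? e = v Fin.≟ lo e ⊎-dec v Fin.≟ hi e

  disjoint? : Decidable (Disjoint {G = G})
  disjoint? e f = Fin.all? λ v → ¬? (v ∈ᵉ? e ×-dec v ∈ᵉ? f)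

  disjoint-sym : Symmetric (Disjoint {G = G})
  disjoint-sym d v (p , q) = d v (q , p)

  disjoint-irrefl : ∀ {e : Edge G} → ¬ Disjoint e e
  disjoint-irrefl {e} d = d (lo e) (inj₁ refl , inj₁ refl)

  edgesBetween : Fin n → Fin n → List (Edge G)
  edgesBetween u v with u Fin.<? v | adj? G u v
  ... | yes u<v | yes uv = [ mkEdge u v u<v uv ]
  ... | _       | _      = []

  allEdges : List (Edge G)
  allEdges = concatMap (uncurry edgesBetween) (cartesianProduct (allFin n) (allFin n))

  ∈-edgesBetween : ∀ e → e ∈ edgesBetween (lo e) (hi e)
  ∈-edgesBetween (mkEdge u v u<v uv) with u Fin.<? v | adj? G u v
  ... | yes _  | yes _  = here refl
  ... | yes _  | no ¬uv = contradiction (recompute (adj? G u v) uv) ¬uv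
  ... | no u≮v | _      = contradiction (recompute (u Fin.<? v) u<v) u≮v

  ∈-allEdges : ∀ e → e ∈ allEdges
  ∈-allEdges e = ∈-concat⁺′ (∈-edgesBetween e)
    (∈-map⁺ (uncurry edgesBetween) (∈-cartesianProduct⁺ (∈-allFin (lo e)) (∈-allFin (hi e))))

  matching-≡ : ∀ {k} {L M : OrderedMatching G k} → edges L ≡ edges M → L ≡ M
  matching-≡ refl = refl

  module Matchings (k : ℕ) where

    open CycleJoining _≟ᴱ_ Disjoint (λ {e} {f} → disjoint-sym {e} {f})
      (λ {e} → disjoint-irrefl {e}) k public

    matching⇒valid : ∀ (L : OrderedMatching G k) → Valid (toList (edges L))
    matching⇒valid (mkOrderedMatching es _ d) =
      Vec.length-toList es , toList⁺ (recompute (VecPairs.allPairs? disjoint? es) d)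

    valid⇒matching : ∀ (es : Vec (Edge G) k) → .(Valid (toList es)) → OrderedMatching G k
    valid⇒matching es v =
      mkOrderedMatching es (toList⁻ es (valid⇒unique {toList es} v)) (toList⁻ es (proj₂ v))

    valid? : ∀ es → Dec (Valid es)
    valid? es = length es ℕ.≟ k ×-dec AllPairs.allPairs? disjoint? es

    -- Repetitions here would do no harm: `extend` inserts nothing for a list already present.
    candidates : List (List (Edge G))
    candidates = filter valid? (listsOf allEdges k)

    ∈-candidates : ∀ {es} → Valid es → es ∈ candidates
    ∈-candidates {es} v =
      ∈-filter⁺ valid? (subst (λ l → es ∈ listsOf allEdges l) (proj₁ v) (∈-listsOf ∈-allEdges es)) v

    -- The windows are the entries of `L`, which is complete and free of repetitions; the bijection
    -- and the unique positions are both lookups in `L`.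
    joined⇒universal : ∀ {L} → Joined L → (∀ {es} → Valid es → es ∈ L) → HasUniversalCycle G k
    joined⇒universal {L} J complete with c , read ← cycle-windows J =
      length L , c
      , mk↔ₛ′ to from (matching-≡ ∘ window-from) (λ i → injective (trans (from-lookup (to i)) (read i)))
      , λ M → from M , window-from M , λ {j} e →
          injective (trans (from-lookup M) (trans (cong toList (sym e)) (read j)))
      where
      injective : ∀ {i j} → lookup L i ≡ lookup L j → i ≡ j
      injective = lookup-injective (unique J) _ _
      to : Fin (length L) → OrderedMatching G k
      to i = valid⇒matching (window c k i)
        (subst Valid (sym (read i)) (All.lookup (valid J) (∈-lookup i)))
      from : OrderedMatching G k → Fin (length L)
      from M = Any.index (complete (matching⇒valid M))
      from-lookup : ∀ M → lookup L (from M) ≡ toList (edges M)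
      from-lookup M = sym (Any.lookup-index (complete (matching⇒valid M)))
      window-from : ∀ M → window c k (from M) ≡ edges M
      window-from M = toList-inj _ _ (trans (read (from M)) (from-lookup M))

    -- Start with the orbit of one matching and absorb all the others.
    connected⇒universal : k ≥ 1 → (∀ {x y} → Valid x → Valid y → x ⇝ y) → HasUniversalCycle G k
    connected⇒universal k≥1 connected =
      cover candidates (All.all-filter valid? (listsOf allEdges k)) ∈-candidates
      where
      cover : ∀ L → All Valid L → (∀ {es} → Valid es → es ∈ L) → HasUniversalCycle G k
      -- There is no ordered matching, and the empty sequence serves.
      cover []      _        complete = joined⇒universal {[]}
        (record { base = [] ; path = [] ; unique = [] ; valid = [] ; rotates = λ () }) complete
      cover (x ∷ L) (v ∷ vs) complete with initLast x
      ... | []      = contradiction (subst (1 ℕ.≤_) (sym (proj₁ v)) k≥1) λ ()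
      ... | u ∷ʳ′ b
        with _ , J , _ , all∈ ← extend-all (orbit-joined u v) (orbit-self u)
                               (All.map (connected v) (v ∷ vs))
        = joined⇒universal J (All.lookup all∈ ∘ complete)

toVec : ∀ {A : Set} {n} (xs : List A) → length xs ≡ n → ∃ λ (v : Vec A n) → toList v ≡ xs
toVec xs refl = fromList xs , Vec.toList∘fromList xs

block : ∀ {A : Set} → (ℕ → A) → ℕ → ℕ → List A
block h zero    p = []
block h (suc j) p = h p ∷ block h j (suc p)

block-∷ʳ : ∀ {A : Set} (h : ℕ → A) j p → block h (suc j) p ≡ block h j p ∷ʳ h (j + p)
block-∷ʳ h zero    p = refl
block-∷ʳ h (suc j) p = cong (h p ∷_)
  (trans (block-∷ʳ h j (suc p)) (cong (λ q → block h j (suc p) ∷ʳ h q) (ℕ.+-suc j p)))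

toList-tabulate-block : ∀ {A : Set} (h : ℕ → A) n p →
                        toList (tabulate {n = n} λ j → h (p + toℕ j)) ≡ block h n p
toList-tabulate-block h zero    p = refl
toList-tabulate-block h (suc n) p = cong₂ _∷_ (cong h (ℕ.+-identityʳ p))
  (trans (cong toList (Vec.tabulate-cong λ j → cong h (ℕ.+-suc p (toℕ j))))
    (toList-tabulate-block h n (suc p)))

-- Complete graphs

module _ {n : ℕ} where

  open import Data.List.Membership.DecPropositional (Fin._≟_ {n}) using (_∈?_)

  unique⇒length≤ : ∀ {w : List (Fin n)} → Unique w → length w ℕ.≤ n
  unique⇒length≤ u = Fin.injective⇒≤ (λ {i} {j} → lookup-injective u i j)

  -- Otherwise the positions of the vertices in `w` would inject `Fin n` into a smaller set.
  missing : ∀ {w : List (Fin n)} → length w ℕ.< n → ∃ (_∉ w)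
  missing {w} l<n = Fin.¬∀⟶∃¬ n (_∈ w) (_∈? w) λ all →
    ℕ.<⇒≱ l<n (Fin.injective⇒≤ {f = Any.index ∘ all} λ {i} {j} e →
      trans (Any.lookup-index (all i)) (trans (cong (lookup w) e) (sym (Any.lookup-index (all j)))))

  unique⇒complete : ∀ {w : List (Fin n)} → Unique w → length w ≡ n → ∀ v → v ∈ w
  unique⇒complete {w} u l v with v ∈? w
  ... | yes p = p
  ... | no ¬p = contradiction (unique⇒length≤ (All.¬Any⇒All¬ w ¬p ∷ u))
                  (ℕ.<⇒≱ (s≤s (ℕ.≤-reflexive (sym l))))

  -- The second component records that the vacated vertex is now free, so that a later move may use
  -- it.
  replace-unique : ∀ xs {a b : Fin n} {ys} → Unique (xs ++ a ∷ ys) → b ∉ xs ++ a ∷ ys →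
                   Unique (xs ++ b ∷ ys) × a ∉ xs ++ b ∷ ys
  replace-unique xs {a} {b} {ys} u b∉
    with d ∷ u′ ← AllPairs-resp-↭ (_∘ sym) (shift a xs ys) u
    = AllPairs-resp-↭ (_∘ sym) (↭-sym (shift b xs ys))
        (All.¬Any⇒All¬ _ (b∉ ∘ ↭.∈-resp-↭ (↭-sym (shift a xs ys)) ∘ there) ∷ u′)
    , λ a∈ → case ↭.∈-resp-↭ (shift b xs ys) a∈ of λ
        { (here refl) → b∉ (↭.∈-resp-↭ (↭-sym (shift a xs ys)) (here refl))
        ; (there p)   → All.lookup d p refl }

  -- Entries are put in place one at a time; if the wanted vertex t still sits at a later position,
  -- that position is first vacated onto a vertex that occurs nowhere.
  module Relocation
    (Q : List (Fin n) → Set)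
    (move : ∀ xs {a b} ys → Unique (xs ++ b ∷ ys) → Q (xs ++ a ∷ ys) → Q (xs ++ b ∷ ys))
    where

    place : ∀ done {t} r rs → Unique (done ++ r ∷ rs) → t ∉ done →
            length (done ++ r ∷ rs) ℕ.< n → Q (done ++ r ∷ rs) →
            ∃ λ rs′ → length rs′ ≡ length rs × Unique (done ++ t ∷ rs′) × Q (done ++ t ∷ rs′)
    place done {t} r rs u t∉done l<n q with t ∈? (r ∷ rs)
    ... | yes (here refl) = rs , refl , u , q
    ... | no t∉r∷rs = rs , refl , u′ , move done rs u′ q
      where
      u′ = proj₁ (replace-unique done u (Sum.[ t∉done , t∉r∷rs ]′ ∘ ∈-++⁻ done))
    ... | yes (there t∈rs) with xs , ys , refl ← ∈-∃++ t∈rs | s , s∉ ← missing {done ++ r ∷ rs} l<n =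
      xs ++ s ∷ ys , trans (length-++ xs) (sym (length-++ xs)) , u″ , move done (xs ++ s ∷ ys) u″
        (subst Q (assoc s) (move (done ++ r ∷ xs) ys (proj₁ vacated) (subst Q (sym (assoc t)) q)))
      where
      assoc : ∀ z → (done ++ r ∷ xs) ++ z ∷ ys ≡ done ++ r ∷ xs ++ z ∷ ys
      assoc z = ++-assoc done (r ∷ xs) (z ∷ ys)
      vacated : Unique ((done ++ r ∷ xs) ++ s ∷ ys) × t ∉ (done ++ r ∷ xs) ++ s ∷ ys
      vacated = replace-unique (done ++ r ∷ xs)
        (subst Unique (sym (assoc t)) u) (subst (s ∉_) (sym (assoc t)) s∉)
      u″ : Unique (done ++ t ∷ xs ++ s ∷ ys)
      u″ = proj₁ (replace-unique done
        (subst Unique (assoc s) (proj₁ vacated)) (subst (t ∉_) (assoc s) (proj₂ vacated)))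

    -- `done` already agrees with the target. Vacating may alter the remaining entries, but never
    -- their number, so a spare vertex exists throughout.
    relocate : ∀ done w t → Unique (done ++ w) → Unique (done ++ t) → length w ≡ length t →
               length (done ++ w) ℕ.< n → Q (done ++ w) → Q (done ++ t)
    relocate done []       []       u u′ e l<n q = q
    relocate done (r ∷ rs) (t ∷ ts) u u′ e l<n q
      with d ∷ _ ← AllPairs-resp-↭ (_∘ sym) (shift t done ts) u′
      with rs′ , l , u″ , q′ ← place done r rs u (λ p → All.lookup d (∈-++⁺ˡ p) refl) l<n q
      = subst Q (∷ʳ-++ done t ts) (relocate (done ∷ʳ t) rs′ ts
          (subst Unique (sym (∷ʳ-++ done t rs′)) u″) (subst Unique (sym (∷ʳ-++ done t ts)) u′)
          (trans l (ℕ.suc-injective e)) (subst (ℕ._< n) (same-length l) l<n)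
          (subst Q (sym (∷ʳ-++ done t rs′)) q′))
      where
      open ≡-Reasoning
      same-length : ∀ {rs′} → length rs′ ≡ length rs →
                    length (done ++ r ∷ rs) ≡ length ((done ∷ʳ t) ++ rs′)
      same-length {rs′} l = begin
        length (done ++ r ∷ rs)        ≡⟨ length-++ done ⟩
        length done + suc (length rs)  ≡⟨ cong (λ m → length done + suc m) l ⟨
        length done + suc (length rs′) ≡⟨ length-++ done ⟨
        length (done ++ t ∷ rs′)       ≡⟨ cong length (∷ʳ-++ done t rs′) ⟨
        length ((done ∷ʳ t) ++ rs′)    ∎

-- Matchings as lists of distinct vertices

module _ {n : ℕ} where

  open Edges (K n)

  lo≢hi : ∀ (e : Edge (K n)) → lo e ≢ hi e
  lo≢hi (mkEdge u v u<v _) = Fin.<⇒≢ (recompute (u Fin.<? v) u<v)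

  -- The two ends of `e` cannot fall on one end of `f`, and a crossed match would contradict the
  -- order of the endpoints.
  same-ends : ∀ {e f : Edge (K n)} → lo e ∈ᵉ f → hi e ∈ᵉ f → e ≡ f
  same-ends (inj₁ p) (inj₂ q) = edge-≡ p q
  same-ends {e} (inj₁ p) (inj₁ q) = contradiction (trans p (sym q)) (lo≢hi e)
  same-ends {e} (inj₂ p) (inj₂ q) = contradiction (trans p (sym q)) (lo≢hi e)
  same-ends {mkEdge u v u<v _} {mkEdge w x w<x _} (inj₂ refl) (inj₁ refl) =
    contradiction (recompute (u Fin.<? v) u<v) (Fin.<-asym (recompute (w Fin.<? x) w<x))

  flatten : List (Edge (K n)) → List (Fin n)
  flatten []       = []
  flatten (e ∷ es) = lo e ∷ hi e ∷ flatten es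

  length-flatten : ∀ es → length (flatten es) ≡ length es * 2
  length-flatten []       = refl
  length-flatten (e ∷ es) = cong (suc ∘ suc) (length-flatten es)

  flatten-∈ : ∀ {v} es → v ∈ flatten es → ∃ λ e → e ∈ es × v ∈ᵉ e
  flatten-∈ (e ∷ es) (here p)         = e , here refl , inj₁ p
  flatten-∈ (e ∷ es) (there (here p)) = e , here refl , inj₂ p
  flatten-∈ (e ∷ es) (there (there p)) with f , q , r ← flatten-∈ es p = f , there q , r

  flatten-unique : ∀ {es} → AllPairs Disjoint es → Unique (flatten es)
  flatten-unique [] = []
  flatten-unique {e ∷ es} (d ∷ ds) =
    (lo≢hi e ∷ All.¬Any⇒All¬ _ (fresh (inj₁ refl))) ∷
    All.¬Any⇒All¬ _ (fresh (inj₂ refl)) ∷ flatten-unique ds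
    where
    fresh : ∀ {v} → v ∈ᵉ e → v ∉ flatten es
    fresh p q with f , r , s ← flatten-∈ es q = All.lookup d r _ (p , s)

  module Pairing (e₀ : Edge (K n)) where

    -- The value e₀ on the diagonal is junk.
    join : Fin n → Fin n → Edge (K n)
    join u v with Fin.<-cmp u v
    ... | tri< u<v u≢v _ = mkEdge u v u<v u≢v
    ... | tri≈ _ _ _     = e₀
    ... | tri> _ u≢v v<u = mkEdge v u v<u (u≢v ∘ sym)

    join-lo-hi : ∀ e → join (lo e) (hi e) ≡ e
    join-lo-hi (mkEdge u v u<v _) with Fin.<-cmp u v
    ... | tri< _ _ _   = refl
    ... | tri≈ u≮v _ _ = contradiction (recompute (u Fin.<? v) u<v) u≮v
    ... | tri> u≮v _ _ = contradiction (recompute (u Fin.<? v) u<v) u≮v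

    ∈ᵉ-join⁻ : ∀ {u v w} → u ≢ v → w ∈ᵉ join u v → w ≡ u ⊎ w ≡ v
    ∈ᵉ-join⁻ {u} {v} u≢v p with Fin.<-cmp u v | p
    ... | tri< _ _ _   | q      = q
    ... | tri≈ _ u≡v _ | _      = contradiction u≡v u≢v
    ... | tri> _ _ _   | inj₁ q = inj₂ q
    ... | tri> _ _ _   | inj₂ q = inj₁ q

    ∈ᵉ-joinˡ : ∀ {u v} → u ≢ v → u ∈ᵉ join u v
    ∈ᵉ-joinˡ {u} {v} u≢v with Fin.<-cmp u v
    ... | tri< _ _ _   = inj₁ refl
    ... | tri≈ _ u≡v _ = contradiction u≡v u≢v
    ... | tri> _ _ _   = inj₂ refl

    ∈ᵉ-joinʳ : ∀ {u v} → u ≢ v → v ∈ᵉ join u v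
    ∈ᵉ-joinʳ {u} {v} u≢v with Fin.<-cmp u v
    ... | tri< _ _ _   = inj₂ refl
    ... | tri≈ _ u≡v _ = contradiction u≡v u≢v
    ... | tri> _ _ _   = inj₁ refl

    pairs : List (Fin n) → List (Edge (K n))
    pairs (u ∷ v ∷ w) = join u v ∷ pairs w
    pairs _           = []

    pairs-flatten : ∀ es → pairs (flatten es) ≡ es
    pairs-flatten []       = refl
    pairs-flatten (e ∷ es) = cong₂ _∷_ (join-lo-hi e) (pairs-flatten es)

    length-pairs : ∀ {k} w → length w ≡ k * 2 → length (pairs w) ≡ k
    length-pairs {zero}  []          _ = refl
    length-pairs {suc k} (_ ∷ _ ∷ w) l = cong suc (length-pairs w (ℕ.suc-injective (ℕ.suc-injective l)))

    pairs-∈ : ∀ {v e w} → Unique w → e ∈ pairs w → v ∈ᵉ e → v ∈ w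
    pairs-∈ {w = _ ∷ _ ∷ _} ((a≢b ∷ _) ∷ _) (here refl) q with ∈ᵉ-join⁻ a≢b q
    ... | inj₁ e = here e
    ... | inj₂ e = there (here e)
    pairs-∈ {w = _ ∷ _ ∷ _} (_ ∷ _ ∷ u) (there p) q = there (there (pairs-∈ u p q))

    pairs-disjoint : ∀ {w} → Unique w → AllPairs Disjoint (pairs w)
    pairs-disjoint {[]}        _ = []
    pairs-disjoint {_ ∷ []}    _ = []
    pairs-disjoint {a ∷ b ∷ w} ((a≢b ∷ a∉) ∷ b∉ ∷ u) = All.tabulate apart ∷ pairs-disjoint u
      where
      apart : ∀ {f} → f ∈ pairs w → Disjoint (join a b) f
      apart p v (q , r) with ∈ᵉ-join⁻ a≢b q
      ... | inj₁ refl = All.lookup a∉ (pairs-∈ u p r) refl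
      ... | inj₂ refl = All.lookup b∉ (pairs-∈ u p r) refl

    -- Each entry belongs to exactly one pair, since the length is even, so changing it affects a
    -- single edge.
    pairs-replace : ∀ {k a b} xs ys → length (xs ++ a ∷ ys) ≡ k * 2 →
                    ∃₂ λ us vs → ∃₂ λ e f →
                    pairs (xs ++ a ∷ ys) ≡ us ++ e ∷ vs × pairs (xs ++ b ∷ ys) ≡ us ++ f ∷ vs
    pairs-replace {suc k} []           (_ ∷ ys) _ = [] , pairs ys , _ , _ , refl , refl
    pairs-replace {suc k} (_ ∷ [])     ys       _ = [] , pairs ys , _ , _ , refl , refl
    pairs-replace {suc k} (x ∷ y ∷ xs) ys       l
      with us , vs , e , f , p , q ← pairs-replace {k} xs ys (ℕ.suc-injective (ℕ.suc-injective l))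
      = join x y ∷ us , vs , e , f , cong (join x y ∷_) p , cong (join x y ∷_) q
    pairs-replace {zero} []      _ ()
    pairs-replace {zero} (_ ∷ _) _ ()

  module _ (m : ℕ) where

    private
      k : ℕ
      k = suc m

    open Matchings k

    valid⇒flatten : ∀ {es} → Valid es → Unique (flatten es) × length (flatten es) ≡ k * 2
    valid⇒flatten {es} (l , d) = flatten-unique d , trans (length-flatten es) (cong (_* 2) l)

    connected : k * 2 ℕ.< n → ∀ {x y} → Valid x → Valid y → x ⇝ y
    connected 2k<n {[]}    {y} (() , _)
    connected 2k<n {e₀ ∷ es} {y} vx vy with ux , lx ← valid⇒flatten vx | uy , ly ← valid⇒flatten vy =
      subst (_ ⇝_) (pairs-flatten y) (proj₂ (relocate [] _ (flatten y) ux uy (trans lx (sym ly))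
        (subst (ℕ._< n) (sym lx) 2k<n)
        (lx , subst ((e₀ ∷ es) ⇝_) (sym (pairs-flatten (e₀ ∷ es))) start)))
      where
      open Pairing e₀
      -- Reachability of the matching read off `w`; the length ensures that it has `k` edges.
      Q : List (Fin n) → Set
      Q w = length w ≡ k * 2 × (e₀ ∷ es) ⇝ pairs w
      move : ∀ xs {a b} ys → Unique (xs ++ b ∷ ys) → Q (xs ++ a ∷ ys) → Q (xs ++ b ∷ ys)
      move xs {a} {b} ys u (l , r)
        with us , vs , e , f , p , q ← pairs-replace {k} {a} {b} xs ys l
        = l′ , subst (_ ⇝_) (sym q) (replace-at us vs (subst (_ ⇝_) p r)
            (subst Valid q (length-pairs (xs ++ b ∷ ys) l′ , pairs-disjoint u)))
        where
        l′ : length (xs ++ b ∷ ys) ≡ k * 2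
        l′ = trans (trans (length-++ xs) (sym (length-++ xs))) l
      open Relocation Q move

    universal-below : k * 2 ℕ.< n → HasUniversalCycle (K n) k
    universal-below 2k<n = connected⇒universal (s≤s ℕ.z≤n) (connected 2k<n)

    -- A matching would have more than `n` distinct endpoints, so connectedness is vacuous.
    universal-above : n ℕ.< k * 2 → HasUniversalCycle (K n) k
    universal-above n<2k = connected⇒universal (s≤s ℕ.z≤n) λ vx _ → case valid⇒flatten vx of λ
      { (u , l) → contradiction (subst (ℕ._≤ n) l (unique⇒length≤ u)) (ℕ.<⇒≱ n<2k) }

    -- Perfect matchings

    module Perfect (n≡2k : n ≡ k * 2) where

      perfect⇒covers : ∀ {es} → Valid es → ∀ v → ∃ λ e → e ∈ es × v ∈ᵉ e
      perfect⇒covers {es} vs v with u , l ← valid⇒flatten vs =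
        flatten-∈ es (unique⇒complete u (trans l (sym n≡2k)) v)

      -- Perfection makes `e ∷ es` cover both ends of `f`, and `es` avoids them, so both lie on `e`.
      remaining-edge-unique : ∀ {e f es} → Valid (e ∷ es) → Valid (f ∷ es) → f ≡ e
      remaining-edge-unique {e} {f} {es} ve (_ , d ∷ _) =
        same-ends (covered (inj₁ refl)) (covered (inj₂ refl))
        where
        covered : ∀ {v} → v ∈ᵉ f → v ∈ᵉ e
        covered {v} p with perfect⇒covers ve v
        ... | _ , here refl , q = q
        ... | _ , there r , q = contradiction (p , q) (All.lookup d r v)

      matching-of : ∀ {es} → Valid es → ∃ λ (M : OrderedMatching (K n) k) → toList (edges M) ≡ es
      matching-of {es} v with xs , refl ← toVec es (proj₁ v) = valid⇒matching xs v , refl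

      module Periodicity {N-1} (c : Vector (Edge (K n)) (suc N-1))
                         (cycle : IsUniversalCycle (K n) k c) where

        open Inverse (proj₁ cycle)

        N : ℕ
        N = suc N-1

        position : OrderedMatching (K n) k → Fin N
        position M = proj₁ (proj₂ cycle M)

        at-position : ∀ M → window c k (position M) ≡ edges M
        at-position M = proj₁ (proj₂ (proj₂ cycle M))

        position-to-injective : ∀ {i j} → position (to i) ≡ position (to j) → i ≡ j
        position-to-injective {i} {j} e = begin
          i           ≡⟨ strictlyInverseʳ i ⟨
          from (to i) ≡⟨ cong from (matching-≡ (begin
            edges (to i)                     ≡⟨ at-position (to i) ⟨
            window c k (position (to i))     ≡⟨ cong (window c k) e ⟩
            window c k (position (to j))     ≡⟨ at-position (to j) ⟩
            edges (to j)                     ∎)) ⟩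
          from (to j) ≡⟨ strictlyInverseʳ j ⟩
          j           ∎
          where open ≡-Reasoning

        -- An injection from Fin N to itself is onto, so every window is a matching.
        window-valid : ∀ i → Valid (toList (window c k i))
        window-valid i
          with j , e ← ∈-tabulate⁻ {f = position ∘ to} (unique⇒complete
                 (Unique.tabulate⁺ position-to-injective) (length-tabulate (position ∘ to)) i)
          = subst (Valid ∘ toList) (sym (trans (cong (window c k) e) (at-position (to j))))
              (matching⇒valid (to j))

        h : ℕ → Edge (K n)
        h p = c (p mod N)

        block-valid : ∀ {q} → q ℕ.< N → Valid (block h k q)
        block-valid {q} q<N = subst Valid
          (trans (toList-tabulate-block h k _) (cong (block h k) (Fin.toℕ-fromℕ< q<N)))
          (window-valid (Fin.fromℕ< q<N))

        -- The edge entering at the end of a window and the edge just dropped complete the same `m`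
        -- edges to a perfect matching, so they coincide.
        blocks-⊆ : ∀ {q} → q ℕ.< N → ∀ {e} → e ∈ block h k q → e ∈ block h k 0
        blocks-⊆ {zero}  _      p = p
        blocks-⊆ {suc q} 1+q<N {e} p
          with q<N ← ℕ.<-trans (ℕ.n<1+n q) 1+q<N | shifted ← block-∷ʳ h m (suc q)
          with ∈-++⁻ (block h m (suc q)) (subst (e ∈_) shifted p)
        ... | inj₁ e∈         = blocks-⊆ q<N (there e∈)
        ... | inj₂ (here refl) = blocks-⊆ q<N (here (remaining-edge-unique (block-valid q<N)
                (Valid-resp-↭ (↭-sym (∷↭∷ʳ _ _)) (subst Valid shifted (block-valid 1+q<N)))))

        first-edge∈ : ∀ {f es} → Valid (f ∷ es) → f ∈ block h k 0
        first-edge∈ {f} {es} v with M , e ← matching-of v =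
          blocks-⊆ (Fin.toℕ<n (position M)) (here (∷-injectiveˡ (begin
          f ∷ es                            ≡⟨ e ⟨
          toList (edges M)                  ≡⟨ cong toList (at-position M) ⟨
          toList (window c k (position M))  ≡⟨ toList-tabulate-block h k (toℕ (position M)) ⟩
          block h k (toℕ (position M))      ∎)))
          where open ≡-Reasoning

  -- One replacement turns any edge into any other. This includes `n = 2`, where the single edge is
  -- a perfect matching.
  universal-single : HasUniversalCycle (K n) 1
  universal-single = Matchings.connected⇒universal 1 (s≤s ℕ.z≤n) λ
    { {[]}        (() , _)
    ; {_ ∷ _ ∷ _} (() , _)
    ; {_ ∷ []} {[]}        _ (() , _)
    ; {_ ∷ []} {_ ∷ _ ∷ _} _ (() , _)
    ; {_ ∷ []} {_ ∷ []}    _ v → Matchings.replace {u = []} Matchings.start v }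

-- Exchanging endpoints between two edges of the first window gives an edge that meets both of
-- them, hence lies outside that window.
no-universal-perfect : ∀ j → ¬ HasUniversalCycle (K (suc (suc j) * 2)) (suc (suc j))
no-universal-perfect j (zero , c , cycle) = Fin.¬Fin0 (proj₁ (proj₂ cycle (proj₁ some-matching)))
  where
  open Pairing (mkEdge Fin.zero (Fin.suc Fin.zero) (s≤s ℕ.z≤n) λ ())
  -- Pairing consecutive vertices gives a matching, which would need a position in the empty
  -- sequence.
  some-matching = Perfect.matching-of (suc j) refl
    (length-pairs (allFin _) (length-tabulate id) , pairs-disjoint (Unique.allFin⁺ _))
no-universal-perfect j (suc N-1 , c , cycle) = outside (first-edge∈ swapped-valid)
  where
  open Perfect.Periodicity (suc j) refl c cycle
  e₁ = h 0
  e₂ = h 1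
  es = block h j 2
  open Pairing e₁
  open Edges (K (suc (suc j) * 2)) using (module Matchings)
  open Matchings (suc (suc j)) using (Valid)
  first-valid : Valid (e₁ ∷ e₂ ∷ es)
  first-valid = block-valid {0} (s≤s ℕ.z≤n)
  disjoint₁₂ : Disjoint e₁ e₂
  disjoint₁₂ = All.head (AllPairs.head (proj₂ first-valid))
  lo₁≢lo₂ : lo e₁ ≢ lo e₂
  lo₁≢lo₂ e = disjoint₁₂ _ (inj₁ refl , inj₁ e)
  -- Swapping the second and third entries of the flattened matching pairs the lower ends with each
  -- other, and likewise the upper ends.
  exchanged : List (Fin (suc (suc j) * 2))
  exchanged = lo e₁ ∷ lo e₂ ∷ hi e₁ ∷ hi e₂ ∷ flatten es
  swapped-valid : Valid (pairs exchanged)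
  swapped-valid with u , l ← valid⇒flatten (suc j) first-valid =
    length-pairs exchanged l , pairs-disjoint (AllPairs-resp-↭ (_∘ sym) (prep _ (swap _ _ ↭-refl)) u)
  -- Equality with `e₁` would put `lo e₂` on `e₁`; every other edge of the window avoids `lo e₁`.
  outside : join (lo e₁) (lo e₂) ∉ e₁ ∷ e₂ ∷ es
  outside (here e) = disjoint₁₂ _ (subst (lo e₂ ∈ᵉ_) e (∈ᵉ-joinʳ lo₁≢lo₂) , inj₁ refl)
  outside (there p) = All.lookup (AllPairs.head (proj₂ first-valid)) p _ (inj₁ refl , ∈ᵉ-joinˡ lo₁≢lo₂)

-- The exceptional case and the final case distinction

exceptional⇒perfect : ∀ {n k} → Exceptional n k → n ≥ 4 × n ≡ k * 2
exceptional⇒perfect (n≥4 , divides q refl , refl) = n≥4 , cong (_* 2) (sym (m*n/n≡m q 2))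

perfect⇒exceptional : ∀ j → Exceptional (suc (suc j) * 2) (suc (suc j))
perfect⇒exceptional j = s≤s (s≤s (s≤s (s≤s ℕ.z≤n))) , divides (suc (suc j)) refl ,
  sym (m*n/n≡m (suc (suc j)) 2)

theorem4 : (n k : ℕ) → n ≥ 1 → k ≥ 1 →
    (¬ Exceptional n k → HasUniversalCycle (K n) k) ×
    (Exceptional n k → ¬ HasUniversalCycle (K n) k)
-- For `k = 1` an exceptional pair would force `n = 2`, against `n ≥ 4`.
theorem4 n 1 _ _ = (λ _ → universal-single) , λ exc → case exceptional⇒perfect exc of λ
  { (n≥4 , refl) → contradiction n≥4 λ { (s≤s (s≤s ())) } }
theorem4 n (suc (suc j)) _ _ = exists , λ exc → case exceptional⇒perfect exc of λ
  { (_ , refl) → no-universal-perfect j }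
  where
  exists : ¬ Exceptional n (suc (suc j)) → HasUniversalCycle (K n) (suc (suc j))
  exists ¬exc with ℕ.<-cmp (suc (suc j) * 2) n
  ... | tri< 2k<n _ _ = universal-below (suc j) 2k<n
  ... | tri≈ _ refl _ = contradiction (perfect⇒exceptional j) ¬exc
  ... | tri> _ _ n<2k = universal-above (suc j) n<2k
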